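{- Let $\mathcal G=((V,E),(V_1,V_2))$ be a game graph and $T_1,\dots,T_k\subseteq V$ target sets. Let $V^{j^*}$ be the set returned by Algorithm GenBuchiGame (described in the context) on input $\mathcal G$ and the generalized Büchi objective $\bigwedge_{1\le \ell\le k}\text{Büchi}(T_\ell)$. Then each vertex in $V^{j^*}$ is winning for player 1, i.e. from each vertex of $V^{j^*}$ player 1 has a winning strategy in $\mathcal G$ for the objective $\bigwedge_{1\le \ell\le k}\text{Büchi}(T_\ell)$.
   Context: **Games.** A game graph $\mathcal G=((V,E),(V_1,V_2))$ is a finite directed graph $(V,E)$, $E\subseteq V\times V$, with a partition of $V$ into player-1 vertices $V_1$ and player-2 vertices $V_2$; $n=|V|$, $m=|E|$. Every vertex has at least one outgoing edge. $\mathrm{Out}(u)$, $\mathrm{In}(u)$ are the sets of successors and predecessors of $u$, $\mathrm{Outdeg}(u)=|\mathrm{Out}(u)|$ (a graph is added as an argument if needed). A play is an infinite path; at a vertex of $V_p$ player $p$ chooses the successor via a strategy, a function of the finite history. $\mathrm{Inf}(\omega)$ is the set of vertices occurring infinitely often in the play $\omega$. $\bigwedge_{\ell}\text{Büchi}(T_\ell)$ is the set of plays with $\mathrm{Inf}(\omega)\cap T_\ell\ne\emptyset$ for all $1\le\ell\le k$. This is player 1's objective; player 2 has the complementary objective. A strategy of a player is winning from $v$ if every play from $v$ consistent with it satisfies that player's objective. **Attractors.** For $p\in\{1,2\}$ with opponent $\bar p$ and $U\subseteq V$: $R_0=U$, $R_{j+1}=R_j\cup\{v\in V_p\mid \mathrm{Out}(v)\cap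 R_j\ne\emptyset\}\cup\{v\in V_{\bar p}\mid \mathrm{Out}(v)\subseteq R_j\}$, and $\mathit{Attr}_p(\mathcal G,U)=\bigcup_j R_j$. $\mathcal G\setminus X$ is the game graph induced by $V\setminus X$. **Hierarchical graph decomposition.** For a game graph on $G=(V,E)$, fix for each vertex an order of its incoming edges in which edges from $V_2$ precede edges from $V_1$. For $i\ge1$, $G_i=(V,E_i)$, where $E_i$ contains all outgoing edges of every $v$ with $\mathrm{Outdeg}(G,v)\le 2^i$ and the first $2^i$ incoming edges of every vertex. $\mathcal G_i=(G_i,(V_1,V_2))$. **Algorithm GenBuchiGame.** Let $n=|V|$ be the number of vertices of the input and let $I$ be the least integer $I\ge 1$ with $2^I\ge n$. Set $\mathcal G^1=\mathcal G$, $T^1_\ell=T_\ell$. For $j=1,2,\dots$: let $G^j$ be the graph of $\mathcal G^j$, $V^j$ its vertex set. For $i=1,\dots,I$ (in this order): construct $G^j_i$ (the $i$th graph of the decomposition of $G^j$); let $Z^j_i=\{v\in V_2\cap V^j\mid \mathrm{Outdeg}(G^j_i,v)=0\}\cup\{v\in V_1\cap V^j\mid\mathrm{Outdeg}(G^j,v)>2^i\}$; for $\ell=1,\dots,k$: let $Y^j_{\ell,i}=\mathit{Attr}_1(\mathcal G^j_i,T^j_\ell\cup Z^j_i)$ and $S^j=V^j\setminus Y^j_{\ell,i}$; if $S^j\neq\emptyset$, leave both loops. Then let $D^j=\mathit{Attr}_2(\mathcal G^j,S^j)$, $\mathcal G^{j+1}=\mathcal G^j\setminus D^j$, $T^{j+1}_\ell=T^j_\ell\setminus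 D^j$. If $D^j=\emptyset$, stop and return $V^j$ (this $j$ is denoted $j^*$). -}

module Defs where

open import Data.Empty using (⊥-elim)
open import Data.Fin using (Fin)
open import Data.Fin.Properties using () renaming (_≟_ to _≟ᶠ_)
open import Data.Fin.Subset
open import Data.Fin.Subset.Properties
open import Data.List using (List; []; _∷_; take; upTo; applyUpTo; map; concatMap; allFin)
open import Data.List.Membership.Propositional using () renaming (_∈_ to _∈ˡ_)
open import Data.List.Membership.DecPropositional using () renaming (_∈?_ to member?)
open import Data.List.Relation.Unary.All as All using (All; []; _∷_)
open import Data.List.Relation.Unary.All.Properties as All using ()
open import Data.List.Relation.Unary.AllPairs using (AllPairs)
open import Data.List.Relation.Unary.Unique.Propositional using (Unique)
open import Data.Nat using (ℕ; zero; suc; _+_; _∸_; _^_; _≤_; _<_; z≤n; s≤s; _≤?_; _<?_; _≟_)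
open import Data.Nat.Properties using (≤-refl; ≤-trans; ≤-total; ≤⇒≯; n≤1+n; m∸n+n≡m; m≤n⇒m<n∨m≡n; ≤-pred)
open import Data.Product using (∃; _×_; _,_; proj₁; proj₂)
open import Data.Sum using (_⊎_; inj₁; inj₂)
open import Data.Vec using (tabulate)
open import Data.Vec.Properties using (lookup∘tabulate; lookup⇒[]=; []=⇒lookup)
open import Function.Bundles using (_⇔_; mk⇔)
open import Level using (0ℓ)
open import Relation.Binary.PropositionalEquality using (_≡_; refl; sym; trans; cong; subst)
open import Relation.Nullary using (¬_; Dec; yes; no; does; ¬?; _×-dec_; _⊎-dec_; contradiction)
open import Relation.Nullary.Decidable using (dec-true)
import Relation.Unary as U

private
  variable
    N k : ℕ

⟦_⟧ : {P : U.Pred (Fin N) 0ℓ} → U.Decidable P → Subset N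
⟦ P? ⟧ = tabulate (λ v → does (P? v))

∈⟦⟧⁻ : {P : U.Pred (Fin N) 0ℓ} (P? : U.Decidable P) {v : Fin N} → v ∈ ⟦ P? ⟧ → P v
∈⟦⟧⁻ P? {v} v∈ with P? v | trans (sym (lookup∘tabulate (λ w → does (P? w)) v)) ([]=⇒lookup v∈)
... | yes Pv | _  = Pv
... | no  _  | ()

∈⟦⟧⁺ : {P : U.Pred (Fin N) 0ℓ} (P? : U.Decidable P) {v : Fin N} → P v → v ∈ ⟦ P? ⟧
∈⟦⟧⁺ P? {v} Pv = lookup⇒[]= v _ (trans (lookup∘tabulate (λ w → does (P? w)) v) (dec-true (P? v) Pv))

data Player : Set where
  player₁ player₂ : Player

opponent : Player → Player
opponent player₁ = player₂
opponent player₂ = player₁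

_≟ᵖ_ : (p q : Player) → Dec (p ≡ q)
player₁ ≟ᵖ player₁ = yes refl
player₁ ≟ᵖ player₂ = no λ ()
player₂ ≟ᵖ player₁ = no λ ()
player₂ ≟ᵖ player₂ = yes refl

-- A finite directed graph (V , E) with a partition of V between the players,
-- without the requirement that every vertex has a successor: the graphs of the
-- hierarchical decomposition may have dead ends.  Vertices are drawn from a
-- fixed ambient Fin N so that a subgraph keeps the names of its vertices.
record Arena (N : ℕ) : Set where
  field
    V     : Subset N
    Out   : Fin N → Subset N
    owner : Fin N → Player
    E⊆V×V : ∀ {u v} → v ∈ Out u → u ∈ V × v ∈ V

  In : Fin N → Subset N
  In v = ⟦ (λ u → v ∈? Out u) ⟧

  Outdeg : Fin N → ℕ
  Outdeg v = ∣ Out v ∣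

  V[_] : Player → Subset N
  V[ p ] = V ∩ ⟦ (λ v → owner v ≟ᵖ p) ⟧

record GameGraph (N : ℕ) : Set where
  field
    arena : Arena N
  open Arena arena public
  field
    Out-nonempty : ∀ v → v ∈ V → Nonempty (Out v)

_∖_ : Arena N → Subset N → Arena N
G ∖ X = record
  { V     = V ─ X
  ; Out   = λ u → ⟦ edge? u ⟧
  ; owner = owner
  ; E⊆V×V = λ {u} uv → let (v∈Out , u∉X , v∉X) = ∈⟦⟧⁻ (edge? u) uv
                           (u∈V , v∈V) = E⊆V×V v∈Out
                       in x∈p∧x∉q⇒x∈p─q u∈V u∉X , x∈p∧x∉q⇒x∈p─q v∈V v∉X
  }
  where
  open Arena G
  edge? : ∀ u v → Dec (v ∈ Out u × u ∉ X × v ∉ X)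
  edge? u v = (v ∈? Out u) ×-dec (¬? (u ∈? X)) ×-dec (¬? (v ∈? X))

module _ (G : Arena N) where
  open Arena G

  attrStep : Player → Subset N → Subset N
  attrStep p R = R ∪ (V[ p ] ∩ ⟦ (λ v → nonempty? (Out v ∩ R)) ⟧)
                   ∪ (V[ opponent p ] ∩ ⟦ (λ v → Out v ⊆? R) ⟧)

  attrStage : Player → Subset N → ℕ → Subset N
  attrStage p U zero    = U
  attrStage p U (suc j) = attrStep p (attrStage p U j)

  -- The union of all attrStage p U j, which is reached after at most N steps;
  -- see ∈Attr.
  Attr : Player → Subset N → Subset N
  Attr p U = attrStage p U N

  module _ (p : Player) (U : Subset N) where
    private
      R : ℕ → Subset N
      R = attrStage p U

      R-suc : ∀ j → R j ⊆ R (suc j)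
      R-suc j v∈ = x∈p∪q⁺ (inj₁ v∈)

      R-mono : ∀ {i j} → i ≤ j → R i ⊆ R j
      R-mono {j = zero}  z≤n v∈ = v∈
      R-mono {j = suc j} i≤ v∈ with m≤n⇒m<n∨m≡n i≤
      ... | inj₁ i<    = R-suc j (R-mono (≤-pred i<) v∈)
      ... | inj₂ refl  = v∈

      grow : ∀ j → j ≤ ∣ R j ∣ ⊎ ∃ λ i → i < j × R (suc i) ⊆ R i
      grow zero = inj₁ z≤n
      grow (suc j) with grow j
      ... | inj₂ (i , i<j , s) = inj₂ (i , ≤-trans i<j (n≤1+n j) , s)
      ... | inj₁ j≤ with R (suc j) ⊆? R j
      ...   | yes s  = inj₂ (j , ≤-refl , s)
      ...   | no ¬s  with R j ⊂? R (suc j)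
      ...     | yes st = inj₁ (≤-trans (s≤s j≤) (p⊂q⇒∣p∣<∣q∣ st))
      ...     | no ¬st = ⊥-elim (¬s λ {x} x∈ → back x x∈)
        where
        back : ∀ x → x ∈ R (suc j) → x ∈ R j
        back x x∈ with x ∈? R j
        ... | yes y = y
        ... | no ¬y = ⊥-elim (¬st (R-suc j , x , x∈ , ¬y))

      stable : ∃ λ i → i ≤ N × R (suc i) ⊆ R i
      stable with grow (suc N)
      ... | inj₁ N<             = contradiction N< (≤⇒≯ (∣p∣≤n (R (suc N))))
      ... | inj₂ (i , i<sN , s) = i , ≤-pred i<sN , s

      constant : ∀ {i} → R (suc i) ≡ R i → ∀ d → R (d + i) ≡ R i
      constant eq zero    = refl
      constant eq (suc d) = trans (cong (attrStep p) (constant eq d)) eq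

      R⊆Attr : ∀ j → R j ⊆ Attr p U
      R⊆Attr j v∈ with stable
      ... | i , i≤N , s with ≤-total j i
      ...   | inj₁ j≤i = R-mono (≤-trans j≤i i≤N) v∈
      ...   | inj₂ i≤j = R-mono i≤N (subst (_ ∈_)
                (trans (cong R (sym (m∸n+n≡m i≤j))) (constant {i} (⊆-antisym s (R-suc i)) (j ∸ i))) v∈)

    ∈Attr : ∀ {v} → v ∈ Attr p U ⇔ ∃ λ j → v ∈ attrStage p U j
    ∈Attr = mk⇔ (N ,_) (λ (j , v∈) → R⊆Attr j v∈)

    Attr⊆V : U ⊆ V → Attr p U ⊆ V
    Attr⊆V U⊆V = go N
      where
      go : ∀ j → R j ⊆ V
      go zero    v∈ = U⊆V v∈
      go (suc j) v∈ with x∈p∪q⁻ _ _ v∈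
      ... | inj₁ a = go j a
      ... | inj₂ b with x∈p∪q⁻ _ _ b
      ...   | inj₁ c = proj₁ (x∈p∩q⁻ _ _ (proj₁ (x∈p∩q⁻ _ _ c)))
      ...   | inj₂ c = proj₁ (x∈p∩q⁻ _ _ (proj₁ (x∈p∩q⁻ _ _ c)))

-- For every vertex, an order of its incoming edges (listed by their sources)
-- in which edges from V₂ precede edges from V₁.
record InOrder (G : Arena N) : Set where
  open Arena G
  field
    inList   : Fin N → List (Fin N)
    unique   : ∀ v → Unique (inList v)
    complete : ∀ u v → u ∈ˡ inList v ⇔ u ∈ In v
    V₂-first : ∀ v → AllPairs (λ u w → w ∈ V[ player₂ ] → u ∈ V[ player₂ ]) (inList v)

decompose : (G : Arena N) → InOrder G → ℕ → Arena N
decompose G o i = record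
  { V     = V
  ; Out   = λ u → ⟦ edge? u ⟧
  ; owner = owner
  ; E⊆V×V = λ {u} uv → E⊆V×V (proj₁ (∈⟦⟧⁻ (edge? u) uv))
  }
  where
  open Arena G
  open InOrder o
  edge? : ∀ u v → Dec (v ∈ Out u × (Outdeg u ≤ 2 ^ i ⊎ u ∈ˡ take (2 ^ i) (inList v)))
  edge? u v = (v ∈? Out u) ×-dec
              ((Outdeg u ≤? 2 ^ i) ⊎-dec member? _≟ᶠ_ u (take (2 ^ i) (inList v)))

firstNonempty : List (Subset N) → Subset N
firstNonempty []       = ⊥
firstNonempty (S ∷ Ss) with nonempty? S
... | yes _ = S
... | no  _ = firstNonempty Ss

firstNonempty⊆ : ∀ {V : Subset N} Ss → All (λ S → ∀ v → v ∈ S → v ∈ V) Ss → firstNonempty Ss ⊆ V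
firstNonempty⊆ []       []       v∈ = ⊥-elim (∉⊥ v∈)
firstNonempty⊆ (S ∷ Ss) (s ∷ ss) v∈ with nonempty? S
... | yes _ = s _ v∈
... | no  _ = firstNonempty⊆ Ss ss v∈

module Iteration (G : Arena N) (o : InOrder G) (I : ℕ) (T : Fin k → Subset N) where
  open Arena G

  Gᵢ : ℕ → Arena N
  Gᵢ = decompose G o

  Z : ℕ → Subset N
  Z i = (V[ player₂ ] ∩ ⟦ (λ v → Arena.Outdeg (Gᵢ i) v ≟ 0) ⟧)
      ∪ (V[ player₁ ] ∩ ⟦ (λ v → 2 ^ i <? Outdeg v) ⟧)

  Y : Fin k → ℕ → Subset N
  Y ℓ i = Attr (Gᵢ i) player₁ (T ℓ ∪ Z i)

  candidates : List (Subset N)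
  candidates = concatMap (λ i → map (λ ℓ → V ─ Y ℓ i) (allFin k)) (map suc (upTo I))

  -- If both loops run to completion, the last set computed is empty.
  S : Subset N
  S = firstNonempty candidates

  D : Subset N
  D = Attr G player₂ S

  D⊆V : D ⊆ V
  D⊆V = Attr⊆V G player₂ S (firstNonempty⊆ candidates
    (All.concat⁺ (All.map⁺ (All.universal
      (λ i → All.map⁺ (All.universal {P = λ ℓ → ∀ v → v ∈ V ─ Y ℓ i → v ∈ V}
        (λ ℓ v → p─q⊆p V (Y ℓ i)) (allFin k)))
      (map suc (upTo I))))))

-- The choice of an order for every graph met by the algorithm is a parameter.
module GenBuchiGame (order : (G : Arena N) → InOrder G) (I : ℕ)
                    (G : Arena N) (T : Fin k → Subset N) where

  -- Iterations are numbered from 0 rather than from 1.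
  mutual
    graph : ℕ → Arena N
    graph zero    = G
    graph (suc j) = graph j ∖ D j

    target : ℕ → Fin k → Subset N
    target zero    ℓ = T ℓ
    target (suc j) ℓ = target j ℓ ─ D j

    D : ℕ → Subset N
    D j = Iteration.D (graph j) (order (graph j)) I (target j)

  IsLastIteration : ℕ → Set
  IsLastIteration j = Empty (D j) × (∀ i → i < j → Nonempty (D i))

  private
    shrinks : ∀ j → Nonempty (D j) → ∣ Arena.V (graph (suc j)) ∣ < ∣ Arena.V (graph j) ∣
    shrinks j (v , v∈D) = p∩q≢∅⇒∣p─q∣<∣p∣ _ _
      (v , x∈p∩q⁺ (Iteration.D⊆V (graph j) (order (graph j)) I (target j) v∈D , v∈D))

    search : ∀ m j → ∣ Arena.V (graph j) ∣ ≤ m → (∀ i → i < j → Nonempty (D i)) →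
             ∃ IsLastIteration
    search m j V≤ before with nonempty? (D j)
    search m       j V≤ before | no  ¬D = j , ¬D , before
    search zero    j V≤ before | yes ne = contradiction (≤-trans (shrinks j ne) V≤) λ ()
    search (suc m) j V≤ before | yes ne =
      search m (suc j) (≤-pred (≤-trans (shrinks j ne) V≤)) before′
      where
      before′ : ∀ i → i < suc j → Nonempty (D i)
      before′ i i<sj with m≤n⇒m<n∨m≡n (≤-pred i<sj)
      ... | inj₁ i<j  = before i i<j
      ... | inj₂ refl = ne

  terminates : ∃ IsLastIteration
  terminates = search _ 0 ≤-refl (λ _ ())

  j* : ℕ
  j* = proj₁ terminates

  result : Subset N
  result = Arena.V (graph j*)

IsLeastExponent : ℕ → ℕ → Set
IsLeastExponent n I = (1 ≤ I × n ≤ 2 ^ I) × (∀ J → 1 ≤ J → n ≤ 2 ^ J → I ≤ J)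

module _ (G : GameGraph N) where
  open GameGraph G

  IsPlay : (ℕ → Fin N) → Set
  IsPlay ω = ∀ t → ω (suc t) ∈ Out (ω t)

  -- move h v is the choice at v after the earlier vertices h, oldest first.
  record Strategy (p : Player) : Set where
    field
      move  : List (Fin N) → Fin N → Fin N
      legal : ∀ h v → v ∈ V[ p ] → move h v ∈ Out v

  Consistent : ∀ {p} → Strategy p → (ℕ → Fin N) → Set
  Consistent {p} σ ω =
    ∀ t → ω t ∈ V[ p ] → ω (suc t) ≡ Strategy.move σ (applyUpTo ω t) (ω t)

  Winning : Player → U.Pred (ℕ → Fin N) 0ℓ → Fin N → Set
  Winning p Φ v = ∃ λ (σ : Strategy p) →
    ∀ ω → IsPlay ω → ω 0 ≡ v → Consistent σ ω → Φ ω

-- Existence is classical here and in Büchi: even for a play visiting a finite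
-- set infinitely often, no vertex visited infinitely often can be computed.
Inf : (ℕ → Fin N) → U.Pred (Fin N) 0ℓ
Inf ω v = ∀ s → ¬ ¬ (∃ λ t → s ≤ t × ω t ≡ v)

Büchi : Subset N → U.Pred (ℕ → Fin N) 0ℓ
Büchi T ω = ¬ U.Empty (Inf ω U.∩ (_∈ T))

GenBüchi : (Fin k → Subset N) → U.Pred (ℕ → Fin N) 0ℓ
GenBüchi T ω = ∀ ℓ → Büchi (T ℓ) ω

{-# OPTIONS --safe #-}

-- When the algorithm stops, every candidate set is empty.  At level I the
-- decomposition keeps every edge and Z is empty, since 2 ^ I bounds all
-- outdegrees, so the last arena is the player-1 attractor of each of its target
-- sets.  Removing player-2 attractors never lets player 2 leave the remaining
-- arena nor blocks player 1, so player 1 stays in the last arena forever and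
-- attracts the play to the targets in turn.
module Submission where

open import Defs
open import Data.Bool using (if_then_else_)
open import Data.Fin using (Fin; toℕ)
open import Data.Fin.Properties using (toℕ-fromℕ<; toℕ-injective; toℕ<n; sequence) renaming (_≟_ to _≟ᶠ_)
open import Data.Fin.Subset using (Subset; inside; outside; _∈_; _∉_; _⊆_; ∣_∣; _∩_; _∪_; _─_; _-_; Nonempty; Empty)
open import Data.Fin.Subset.Properties using (_∈?_; _⊆?_; nonempty?; x∈p∩q⁺; x∈p∩q⁻; x∈p∪q⁺; x∈p∪q⁻; x∈p∧x∉q⇒x∈p─q; p─q⊆p; p⊆q⇒∣p∣≤∣q∣; x∈p⇒∣p-x∣<∣p∣)
open import Data.List using (List; []; _∷_; take; upTo; map; allFin; foldl; applyUpTo; tabulate)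
open import Data.List.Extrema.Nat using (max; xs≤max)
open import Data.List.Membership.Propositional using (lose) renaming (_∈_ to _∈ˡ_)
open import Data.List.Membership.Propositional.Properties using (∈-concatMap⁺; ∈-map⁺; ∈-upTo⁺; ∈-allFin; ∈-tabulate⁺)
open import Data.List.Membership.DecPropositional using () renaming (_∈?_ to member?)
open import Data.List.Properties using (applyUpTo-∷ʳ; foldl-∷ʳ)
open import Data.List.Relation.Unary.All as All using (All; []; _∷_)
open import Data.Nat using (ℕ; zero; suc; _+_; _*_; _^_; _≤_; _<_; z≤n; _≤?_; _≟_; _<?_)
open import Data.Nat.DivMod using (_%_; _mod_; [m+kn]%n≡m%n; m<n⇒m%n≡m)
open import Data.Nat.Properties using (≤-refl; n≮0; ≤-trans; ≤-pred; <⇒≱; ≰⇒>; n≤1+n; +-suc; +-comm; +-assoc; *-suc; m≤n⇒m<n∨m≡n)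
open import Data.Product using (∃; _×_; _,_; proj₁; proj₂)
open import Data.Sum using (_⊎_; inj₁; inj₂)
open import Data.Vec using (_∷_; there)
open import Effect.Monad using (RawMonad)
open import Function using (_∘_)
open import Function.Bundles using (Equivalence)
open import Relation.Binary.PropositionalEquality using (_≡_; refl; sym; trans; cong; subst; module ≡-Reasoning)
open import Relation.Nullary using (¬_; Dec; yes; no; does; ¬?; _×-dec_; _⊎-dec_; contradiction)
open import Relation.Nullary.Decidable using (decidable-stable)
open import Relation.Nullary.Negation using (¬¬-Monad)

private
  variable
    N k : ℕ

-- Attractor stages, closure and descent.

x∈p─q⇒x∉q : ∀ (p q : Subset N) {x} → x ∈ p ─ q → x ∉ q
x∈p─q⇒x∉q (_ ∷ p) (outside ∷ q) (there x∈) (there x∈q) = x∈p─q⇒x∉q p q x∈ x∈q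
x∈p─q⇒x∉q (_ ∷ p) (inside  ∷ q) (there x∈) (there x∈q) = x∈p─q⇒x∉q p q x∈ x∈q

opponent≢ : ∀ p → ¬ p ≡ opponent p
opponent≢ player₁ ()
opponent≢ player₂ ()

module _ (G : Arena N) where
  open Arena G

  owned : ∀ v → owner v ≡ player₁ ⊎ owner v ≡ player₂
  owned v with owner v
  ... | player₁ = inj₁ refl
  ... | player₂ = inj₂ refl

  ∈V[]⁻ : ∀ {p v} → v ∈ V[ p ] → v ∈ V × owner v ≡ p
  ∈V[]⁻ {p} v∈ = let v∈V , v∈p = x∈p∩q⁻ V _ v∈ in v∈V , ∈⟦⟧⁻ (λ v → owner v ≟ᵖ p) v∈p

  ∈V[]⁺ : ∀ {p v} → v ∈ V → owner v ≡ p → v ∈ V[ p ]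
  ∈V[]⁺ {p} v∈V eq = x∈p∩q⁺ (v∈V , ∈⟦⟧⁺ (λ v → owner v ≟ᵖ p) eq)

  Controlled : Player → Subset N → Fin N → Set
  Controlled p R v = (v ∈ V × owner v ≡ p × ∃ λ w → w ∈ Out v × w ∈ R)
                   ⊎ (v ∈ V × owner v ≡ opponent p × Out v ⊆ R)

  attrStep⁻ : ∀ p R {v} → v ∈ attrStep G p R → v ∈ R ⊎ Controlled p R v
  attrStep⁻ p R v∈ with x∈p∪q⁻ R _ v∈
  ... | inj₁ v∈R = inj₁ v∈R
  ... | inj₂ v∈′ with x∈p∪q⁻ (V[ p ] ∩ _) _ v∈′
  ...   | inj₁ a =
    let v∈Vp , ne = x∈p∩q⁻ V[ p ] _ a
        v∈V , own = ∈V[]⁻ v∈Vp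
        w , w∈    = ∈⟦⟧⁻ (λ v → nonempty? (Out v ∩ R)) ne
    in inj₂ (inj₁ (v∈V , own , w , x∈p∩q⁻ _ R w∈))
  ...   | inj₂ b =
    let v∈Vp , s  = x∈p∩q⁻ V[ opponent p ] _ b
        v∈V , own = ∈V[]⁻ v∈Vp
    in inj₂ (inj₂ (v∈V , own , ∈⟦⟧⁻ (λ v → Out v ⊆? R) s))

  attrStep⁺ : ∀ p R {v} → v ∈ R ⊎ Controlled p R v → v ∈ attrStep G p R
  attrStep⁺ p R (inj₁ v∈R) = x∈p∪q⁺ (inj₁ v∈R)
  attrStep⁺ p R (inj₂ (inj₁ (v∈V , own , w , w∈))) = x∈p∪q⁺ (inj₂ (x∈p∪q⁺ (inj₁
    (x∈p∩q⁺ (∈V[]⁺ v∈V own , ∈⟦⟧⁺ (λ v → nonempty? (Out v ∩ R)) (w , x∈p∩q⁺ w∈))))))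
  attrStep⁺ p R (inj₂ (inj₂ (v∈V , own , s))) = x∈p∪q⁺ (inj₂ (x∈p∪q⁺ (inj₂
    (x∈p∩q⁺ (∈V[]⁺ v∈V own , ∈⟦⟧⁺ (λ v → Out v ⊆? R) s)))))

  module _ (p : Player) (U : Subset N) where

    attrStage-mono : ∀ {i j} → i ≤ j → attrStage G p U i ⊆ attrStage G p U j
    attrStage-mono {j = zero}  z≤n v∈ = v∈
    attrStage-mono {j = suc j} i≤j v∈ with m≤n⇒m<n∨m≡n i≤j
    ... | inj₁ i<j  = attrStep⁺ p _ (inj₁ (attrStage-mono (≤-pred i<j) v∈))
    ... | inj₂ refl = v∈

    -- `Attr` is stage `N`, so one more step lands in stage `suc N`, and `∈Attr` brings every stage
    -- back into `Attr`.
    Attr-closed : ∀ {v} → Controlled p (Attr G p U) v → v ∈ Attr G p U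
    Attr-closed c = Equivalence.from (∈Attr G p U) (suc N , attrStep⁺ p _ (inj₂ c))

    U⊆Attr : U ⊆ Attr G p U
    U⊆Attr v∈ = Equivalence.from (∈Attr G p U) (0 , v∈)

    -- A move that lowers the attractor rank. Quantifying over all stages that contain `v` avoids
    -- naming its least one.
    Descends : Fin N → Fin N → Set
    Descends v w = ∀ i → v ∈ attrStage G p U (suc i) → w ∈ attrStage G p U i

    -- The recursion on `r` goes down to the step at which `v` first enters; the edge that admits
    -- `v` there leads to the stage before.
    descendingMove : ∀ r {v} → v ∈ attrStage G p U r → v ∉ U → owner v ≡ p →
                     ∃ λ w → w ∈ Out v × Descends v w
    descendingMove zero    v∈ v∉U own = contradiction v∈ v∉U
    descendingMove (suc r) {v} v∈ v∉U own with v ∈? attrStage G p U r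
    ... | yes v∈r = descendingMove r v∈r v∉U own
    ... | no  v∉r with attrStep⁻ p _ v∈
    ...   | inj₁ v∈r = contradiction v∈r v∉r
    ...   | inj₂ (inj₂ (_ , own′ , _)) = contradiction (trans (sym own) own′) (opponent≢ p)
    ...   | inj₂ (inj₁ (_ , _ , w , w∈Out , w∈r)) = w , w∈Out , descends
      where
      descends : Descends v w
      descends i v∈i with r ≤? i
      -- Stages from `r` on contain `w`; an earlier `i` would put `v` into stage `r`, before its
      -- entry.
      ... | yes r≤i = attrStage-mono r≤i w∈r
      ... | no  r≰i = contradiction (attrStage-mono (≰⇒> r≰i) v∈i) v∉r

    -- An opponent vertex enters only once all its successors are in, so every move descends. Stage
    -- 0 is excluded by `v ∉ U`.
    opponentDescends : ∀ {v w} → v ∉ U → owner v ≡ opponent p → w ∈ Out v → Descends v w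
    opponentDescends v∉U own w∈Out i v∈ with attrStep⁻ p _ v∈
    ... | inj₂ (inj₁ (_ , own′ , _)) = contradiction (trans (sym own′) own) (opponent≢ p)
    ... | inj₂ (inj₂ (_ , _ , s)) = s w∈Out
    opponentDescends v∉U own w∈Out zero    v∈ | inj₁ v∈U = contradiction v∈U v∉U
    opponentDescends v∉U own w∈Out (suc i) v∈ | inj₁ v∈i =
      attrStep⁺ p _ (inj₁ (opponentDescends v∉U own w∈Out i v∈i))

-- Vertices of `p` carry their attracting edge from `G` to `H`; opponent vertices must gain no
-- escape in `H`. Hence edge inclusions both ways.
attrStage-cong : ∀ (G H : Arena N) p {U U′} → (∀ {v} → v ∈ Arena.V G → v ∈ Arena.V H) →
  (∀ v → Arena.owner G v ≡ Arena.owner H v) →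
  (∀ v → Arena.Out G v ⊆ Arena.Out H v) → (∀ v → Arena.Out H v ⊆ Arena.Out G v) →
  U ⊆ U′ → ∀ i → attrStage G p U i ⊆ attrStage H p U′ i
attrStage-cong G H p V⊆ own Out⊆ Out⊇ U⊆ zero v∈ = U⊆ v∈
attrStage-cong G H p V⊆ own Out⊆ Out⊇ U⊆ (suc i) v∈ with attrStep⁻ G p _ v∈
... | inj₁ v∈i = attrStep⁺ H p _ (inj₁ (attrStage-cong G H p V⊆ own Out⊆ Out⊇ U⊆ i v∈i))
... | inj₂ (inj₁ (v∈V , o , w , w∈ , w∈i)) = attrStep⁺ H p _ (inj₂ (inj₁
  (V⊆ v∈V , trans (sym (own _)) o , w , Out⊆ _ w∈ ,
   attrStage-cong G H p V⊆ own Out⊆ Out⊇ U⊆ i w∈i)))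
... | inj₂ (inj₂ (v∈V , o , s)) = attrStep⁺ H p _ (inj₂ (inj₂
  (V⊆ v∈V , trans (sym (own _)) o ,
   λ w∈ → attrStage-cong G H p V⊆ own Out⊆ Out⊇ U⊆ i (s (Out⊇ _ w∈)))))

-- Traps for player 2.

record Player₂Trap (G H : Arena N) : Set where
  module G = Arena G
  module H = Arena H
  field
    V⊆     : H.V ⊆ G.V
    owner≡ : ∀ v → H.owner v ≡ G.owner v
    Out⊆   : ∀ v → H.Out v ⊆ G.Out v
    live   : ∀ {v} → v ∈ H.V → Nonempty (H.Out v)
    closed : ∀ {v} → v ∈ H.V → H.owner v ≡ player₂ → G.Out v ⊆ H.Out v

Player₂Trap-refl : (𝒢 : GameGraph N) → Player₂Trap (GameGraph.arena 𝒢) (GameGraph.arena 𝒢)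
Player₂Trap-refl 𝒢 = record
  { V⊆ = λ v∈ → v∈ ; owner≡ = λ _ → refl ; Out⊆ = λ _ v∈ → v∈
  ; live = GameGraph.Out-nonempty 𝒢 _ ; closed = λ _ _ v∈ → v∈ }

module _ {G H : Arena N} (trap : Player₂Trap G H) (S : Subset N) where
  open Player₂Trap trap

  private
    A : Subset N
    A = Attr H player₂ S

    edge? : ∀ u v → Dec (v ∈ H.Out u × u ∉ A × v ∉ A)
    edge? u v = (v ∈? H.Out u) ×-dec (¬? (u ∈? A)) ×-dec (¬? (v ∈? A))

    V⁻ : ∀ {v} → v ∈ Arena.V (H ∖ A) → v ∈ H.V × v ∉ A
    V⁻ v∈ = p─q⊆p H.V A v∈ , x∈p─q⇒x∉q H.V A v∈

  -- A player-2 vertex with an edge into `A` would itself be attracted, and so would a vertex of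
  -- either player all of whose edges lead into `A`.
  Player₂Trap-∖Attr : Player₂Trap G (H ∖ A)
  Player₂Trap-∖Attr = record
    { V⊆     = V⊆ ∘ proj₁ ∘ V⁻
    ; owner≡ = owner≡
    ; Out⊆   = λ v w∈ → Out⊆ v (proj₁ (∈⟦⟧⁻ (edge? v) w∈))
    ; live   = live′
    ; closed = λ {v} v∈ own {w} w∈ → let v∈V , v∉A = V⁻ v∈ ; w∈Out = closed v∈V own w∈ in
        ∈⟦⟧⁺ (edge? v) (w∈Out , v∉A ,
          λ w∈A → v∉A (Attr-closed H player₂ S (inj₁ (v∈V , own , w , w∈Out , w∈A))))
    }
    where
    live′ : ∀ {v} → v ∈ Arena.V (H ∖ A) → Nonempty (Arena.Out (H ∖ A) v)
    live′ {v} v∈ with nonempty? (Arena.Out (H ∖ A) v)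
    ... | yes ne = ne
    ... | no ¬ne = contradiction (Attr-closed H player₂ S controlled) v∉A
      where
      v∈V : v ∈ H.V
      v∈V = proj₁ (V⁻ v∈)

      v∉A : v ∉ A
      v∉A = proj₂ (V⁻ v∈)

      Out⊆A : H.Out v ⊆ A
      Out⊆A {w} w∈ = decidable-stable (w ∈? A) λ w∉A → ¬ne (w , ∈⟦⟧⁺ (edge? v) (w∈ , v∉A , w∉A))

      controlled : Controlled H player₂ A v
      controlled with owned H v
      ... | inj₁ own = inj₂ (v∈V , own , Out⊆A)
      ... | inj₂ own = let w , w∈ = live v∈V in inj₁ (v∈V , own , w , w∈ , Out⊆A w∈)

-- A scheduled attractor strategy inside a trap.

module _ {𝒢 : GameGraph N} where
  open GameGraph 𝒢

  -- Strategies are total functions on `Fin N`; outside `V` the vertex itself is a default value.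
  legalSuccessor : ∀ v → ∃ λ w → v ∈ V → w ∈ Out v
  legalSuccessor v with nonempty? (Out v)
  ... | yes (w , w∈) = w , λ _ → w∈
  ... | no  ¬ne      = v , λ v∈V → contradiction (Out-nonempty v v∈V) ¬ne

  module _ {H : Arena N} (trap : Player₂Trap arena H) (U : Fin k → Subset N)
           (V⊆Attr : ∀ ℓ → Arena.V H ⊆ Attr H player₁ (U ℓ)) where
    open Player₂Trap trap using (module H; V⊆; owner≡; Out⊆; live; closed)

    -- Legality is asked on all of `𝒢`, as a strategy must be legal everywhere; the other two fields
    -- concern only player-1 vertices of the trap.
    record GoodMove (ℓ : Fin k) (v w : Fin N) : Set where
      field
        legal    : v ∈ V → w ∈ Out v
        stays    : v ∈ H.V → H.owner v ≡ player₁ → w ∈ H.Out v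
        descends : v ∈ H.V → H.owner v ≡ player₁ → v ∉ U ℓ → Descends H player₁ (U ℓ) v w

    goodMove : ∀ ℓ v → ∃ (GoodMove ℓ v)
    goodMove ℓ v with v ∈? H.V | H.owner v ≟ᵖ player₁
    ... | no v∉V | _ = let w , ok = legalSuccessor v in w , record
      { legal = ok ; stays = λ v∈V → contradiction v∈V v∉V ; descends = λ v∈V → contradiction v∈V v∉V }
    ... | yes _ | no ¬own = let w , ok = legalSuccessor v in w , record
      { legal = ok ; stays = λ _ own → contradiction own ¬own ; descends = λ _ own → contradiction own ¬own }
    ... | yes v∈V | yes own with v ∈? U ℓ
    -- The target is met at `v`, so any edge that stays in the trap will do.
    ...   | yes v∈U = let w , w∈ = live v∈V in w , record
      { legal = λ _ → Out⊆ v w∈ ; stays = λ _ _ → w∈ ; descends = λ _ _ v∉U → contradiction v∈U v∉U }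
    ...   | no v∉U =
      let w , w∈ , desc = descendingMove H player₁ (U ℓ) N (V⊆Attr ℓ v∈V) v∉U own
      in w , record { legal = λ _ → Out⊆ v w∈ ; stays = λ _ _ → w∈ ; descends = λ _ _ _ → desc }

    module _ (schedule : ℕ → Fin k) where

      -- The memory of player 1 is the number of targets of the schedule met so far.
      update : ℕ → Fin N → ℕ
      update c v = if does (v ∈? U (schedule c)) then suc c else c

      counter : List (Fin N) → ℕ
      counter = foldl update 0

      -- The counter is read from the vertices before `v`, so a hit at `v` changes the target only
      -- from the next move on.
      roundRobin : Strategy 𝒢 player₁
      roundRobin = record
        { move  = λ h v → proj₁ (goodMove (schedule (counter h)) v)
        ; legal = λ h v v∈ → GoodMove.legal (proj₂ (goodMove (schedule (counter h)) v))
                                            (proj₁ (∈V[]⁻ arena v∈))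
        }

      module _ {ω : ℕ → Fin N} (play : IsPlay 𝒢 ω) (consistent : Consistent 𝒢 roundRobin ω)
               (start : ω 0 ∈ H.V) where

        private
          c : ℕ → ℕ
          c t = counter (applyUpTo ω t)

          goal : ℕ → Subset N
          goal t = U (schedule (c t))

          c-suc : ∀ t → c (suc t) ≡ update (c t) (ω t)
          c-suc t = trans (cong counter (sym (applyUpTo-∷ʳ ω t)))
                          (foldl-∷ʳ update 0 (ω t) (applyUpTo ω t))

          c-hit : ∀ t → ω t ∈ goal t → c (suc t) ≡ suc (c t)
          c-hit t hit with ω t ∈? goal t | c-suc t
          ... | yes _   | eq = eq
          ... | no miss | _  = contradiction hit miss

          c-miss : ∀ t → ω t ∉ goal t → c (suc t) ≡ c t
          c-miss t miss with ω t ∈? goal t | c-suc t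
          ... | no _    | eq = eq
          ... | yes hit | _  = contradiction hit miss

          move₁ : ∀ t → ω t ∈ H.V → H.owner (ω t) ≡ player₁ →
                  GoodMove (schedule (c t)) (ω t) (ω (suc t))
          move₁ t v∈ own = subst (GoodMove (schedule (c t)) (ω t))
            (sym (consistent t (∈V[]⁺ arena (V⊆ v∈) (trans (sym (owner≡ _)) own))))
            (proj₂ (goodMove (schedule (c t)) (ω t)))

        step∈Out : ∀ t → ω t ∈ H.V → ω (suc t) ∈ H.Out (ω t)
        step∈Out t v∈ with owned H (ω t)
        ... | inj₁ own = GoodMove.stays (move₁ t v∈ own) v∈ own
        ... | inj₂ own = closed v∈ own (play t)

        confined : ∀ t → ω t ∈ H.V
        confined zero    = start
        confined (suc t) = proj₂ (H.E⊆V×V (step∈Out t (confined t)))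

        step-descends : ∀ t → ω t ∉ goal t → Descends H player₁ (goal t) (ω t) (ω (suc t))
        step-descends t miss with owned H (ω t)
        ... | inj₁ own = GoodMove.descends (move₁ t (confined t) own) (confined t) own miss
        ... | inj₂ own = opponentDescends H player₁ (goal t) miss own (step∈Out t (confined t))

        -- Until the target is hit the counter, and with it the target, stays fixed while the stage
        -- drops at each step; stage 0 is the target.
        reachGoal : ∀ r t → ω t ∈ attrStage H player₁ (goal t) r →
                    ∃ λ t′ → t ≤ t′ × c t′ ≡ c t × ω t′ ∈ goal t
        reachGoal r t in-r with ω t ∈? goal t
        reachGoal r       t in-r | yes hit  = t , ≤-refl , refl , hit
        reachGoal zero    t in-r | no  miss = contradiction in-r miss
        reachGoal (suc r) t in-r | no  miss =
          let eq                     = c-miss t miss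
              t′ , t≤t′ , eq′ , hit  = reachGoal r (suc t)
                (subst (λ n → ω (suc t) ∈ attrStage H player₁ (U (schedule n)) r) (sym eq)
                       (step-descends t miss r in-r))
          in t′ , ≤-trans (n≤1+n t) t≤t′ , trans eq′ eq ,
             subst (λ n → ω t′ ∈ U (schedule n)) eq hit

        -- Reaching the current target advances the counter by one, so the entry `d` places ahead
        -- becomes current after `d` hits.
        hitsSchedule : ∀ d s → ∃ λ t → s ≤ t × ω t ∈ U (schedule (d + c s))
        hitsSchedule d s with reachGoal N s (V⊆Attr _ (confined s))
        hitsSchedule zero    s | t , s≤t , _ , hit = t , s≤t , hit
        hitsSchedule (suc d) s | t , s≤t , eq , hit =
          let c≡ = trans (c-hit t (subst (λ n → ω t ∈ U (schedule n)) (sym eq) hit)) (cong suc eq)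
              t′ , t<t′ , hit′ = hitsSchedule d (suc t)
          in t′ , ≤-trans s≤t (≤-trans (n≤1+n t) t<t′) ,
             subst (λ n → ω t′ ∈ U (schedule n)) (trans (cong (d +_) c≡) (+-suc d (c s))) hit′

        recurrent : (∀ ℓ s → ∃ λ d → schedule (d + s) ≡ ℓ) → ∀ ℓ s → ∃ λ t → s ≤ t × ω t ∈ U ℓ
        recurrent fair ℓ s =
          -- Fairness finds `ℓ` in the schedule at or after the current counter value.
          let d , eq         = fair ℓ (c s)
              t , s≤t , hit  = hitsSchedule d s
          in t , s≤t , subst (λ ℓ → ω t ∈ U ℓ) eq hit

-- Fairness of the cyclic schedule, and Büchi conditions from recurrence.

mod-fair : ∀ (ℓ : Fin (suc k)) s → ∃ λ d → (d + s) mod suc k ≡ ℓ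
-- The summand `s * k` completes `s` to a multiple of the modulus `suc k`.
mod-fair {k} ℓ s = toℕ ℓ + s * k , toℕ-injective (begin
  toℕ ((toℕ ℓ + s * k + s) mod suc k)  ≡⟨ toℕ-fromℕ< _ ⟩
  (toℕ ℓ + s * k + s) % suc k          ≡⟨ cong (_% suc k) (+-assoc (toℕ ℓ) (s * k) s) ⟩
  (toℕ ℓ + (s * k + s)) % suc k        ≡⟨ cong (λ n → (toℕ ℓ + n) % suc k) (trans (+-comm (s * k) s) (sym (*-suc s k))) ⟩
  (toℕ ℓ + s * suc k) % suc k          ≡⟨ [m+kn]%n≡m%n (toℕ ℓ) s (suc k) ⟩
  toℕ ℓ % suc k                        ≡⟨ m<n⇒m%n≡m (toℕ<n ℓ) ⟩
  toℕ ℓ                                ∎)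
  where open ≡-Reasoning

-- If no vertex of T recurred, then classically each would have a last visit, and
-- the play would avoid T from the latest of these on.
recurrent⇒Büchi : ∀ {ω : ℕ → Fin N} {T} → (∀ s → ∃ λ t → s ≤ t × ω t ∈ T) → Büchi T ω
-- Double negation commutes with a finite conjunction, so `sequence` moves it outside the quantifier
-- over vertices.
recurrent⇒Büchi {N} {ω} {T} rec none = sequence (RawMonad.rawApplicative ¬¬-Monad) finite noneAfter
  where
  AbsentFrom : ℕ → Fin N → Set
  AbsentFrom s v = ∀ t → s ≤ t → ¬ ω t ≡ v

  finite : ∀ v → ¬ ¬ (v ∈ T → ∃ λ s → AbsentFrom s v)
  -- `¬fin` is used twice: here to obtain `v ∈ T`, and in `inf` to refute absence from `s` on.
  finite v ¬fin = ¬fin λ v∈T → contradiction (inf , v∈T) (none v)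
    where
    inf : Inf ω v
    inf s ¬later = ¬fin λ _ → s , λ t s≤t eq → ¬later (t , s≤t , eq)

  noneAfter : ¬ (∀ v → v ∈ T → ∃ λ s → AbsentFrom s v)
  noneAfter absent = let t , bound≤t , t∈T = rec (max 0 (tabulate last)) in
    last-absent t∈T t (≤-trans (All.lookup (xs≤max 0 (tabulate last)) (∈-tabulate⁺ (ω t))) bound≤t) refl
    where
    last : Fin N → ℕ
    last v with v ∈? T
    ... | yes v∈T = proj₁ (absent v v∈T)
    -- The default 0 leaves the maximum unaffected by vertices outside `T`.
    ... | no  _   = 0

    last-absent : ∀ {v} → v ∈ T → AbsentFrom (last v) v
    last-absent {v} v∈T with v ∈? T
    ... | yes v∈T′ = proj₂ (absent v v∈T′)
    ... | no  v∉T  = contradiction v∈T v∉T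

Player₂Trap-Winning : ∀ {𝒢 : GameGraph N} {H} (T U : Fin k → Subset N) → (∀ ℓ → U ℓ ⊆ T ℓ) →
  Player₂Trap (GameGraph.arena 𝒢) H → (∀ ℓ → Arena.V H ⊆ Attr H player₁ (U ℓ)) →
  ∀ v → v ∈ Arena.V H → Winning 𝒢 player₁ (GenBüchi T) v
-- With no targets there is nothing to schedule, and any legal strategy wins vacuously.
Player₂Trap-Winning {k = zero} {𝒢 = 𝒢} T U U⊆T trap V⊆Attr v v∈ =
  record { move  = λ _ v → proj₁ (legalSuccessor {𝒢 = 𝒢} v)
         ; legal = λ _ v v∈ → proj₂ (legalSuccessor {𝒢 = 𝒢} v) (proj₁ (∈V[]⁻ (GameGraph.arena 𝒢) v∈)) } ,
  λ _ _ _ _ ()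
Player₂Trap-Winning {k = suc k} T U U⊆T trap V⊆Attr v v∈ =
  roundRobin trap U V⊆Attr (_mod suc k) ,
  λ { ω play refl consistent ℓ → recurrent⇒Büchi λ s →
      let t , s≤t , hit = recurrent trap U V⊆Attr (_mod suc k) play consistent v∈ mod-fair ℓ s
      in t , s≤t , U⊆T ℓ hit }

-- What an empty `D` says about the arena.

firstNonempty-empty : ∀ (Ss : List (Subset N)) → Empty (firstNonempty Ss) → All Empty Ss
firstNonempty-empty []       _  = []
firstNonempty-empty (S ∷ Ss) em with nonempty? S
... | yes ne = contradiction ne em
... | no ¬ne = ¬ne ∷ firstNonempty-empty Ss em

module _ (G : Arena N) (o : InOrder G) where
  open Arena G

  private
    edge? : ∀ i u v → Dec (v ∈ Out u × (Outdeg u ≤ 2 ^ i ⊎ u ∈ˡ take (2 ^ i) (InOrder.inList o v)))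
    edge? i u v = (v ∈? Out u) ×-dec
                  ((Outdeg u ≤? 2 ^ i) ⊎-dec member? _≟ᶠ_ u (take (2 ^ i) (InOrder.inList o v)))

  decompose-Out⊆ : ∀ i v → Arena.Out (decompose G o i) v ⊆ Out v
  decompose-Out⊆ i v w∈ = proj₁ (∈⟦⟧⁻ (edge? i v) w∈)

  decompose-Out⊇ : ∀ i v → Outdeg v ≤ 2 ^ i → Out v ⊆ Arena.Out (decompose G o i) v
  decompose-Out⊇ i v deg≤ w∈ = ∈⟦⟧⁺ (edge? i v) (w∈ , inj₁ deg≤)

  module _ (I : ℕ) (T : Fin k → Subset N) where
    open Iteration G o I T

    -- `S` lies in its own attractor `D`, so it is empty too, and then so is every candidate
    -- `V ─ Y`. Levels run from 1, hence `suc i`.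
    D-empty⇒V⊆Y : Empty D → ∀ {i} ℓ → i < I → V ⊆ Y ℓ (suc i)
    D-empty⇒V⊆Y D-empty {i} ℓ i<I {v} v∈V =
      decidable-stable (v ∈? Y ℓ (suc i)) λ v∉Y →
        All.lookup (firstNonempty-empty candidates λ (x , x∈S) → D-empty (x , U⊆Attr G player₂ S x∈S))
          (∈-concatMap⁺ (λ i → map (λ ℓ → V ─ Y ℓ i) (allFin k))
            (lose (∈-map⁺ suc (∈-upTo⁺ i<I)) (∈-map⁺ (λ ℓ → V ─ Y ℓ (suc i)) (∈-allFin ℓ))))
          (v , x∈p∧x∉q⇒x∈p─q v∈V v∉Y)

    D-empty⇒V⊆Attr : (∀ {v} → v ∈ V → Nonempty (Out v)) → 1 ≤ I → ∣ V ∣ ≤ 2 ^ I →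
                     Empty D → ∀ ℓ → V ⊆ Attr G player₁ (T ℓ)
    D-empty⇒V⊆Attr live 1≤I V≤ D-empty ℓ v∈V =
      attrStage-cong (Gᵢ I) G player₁ (λ v∈ → v∈) (λ _ → refl) (decompose-Out⊆ I)
        (λ v → decompose-Out⊇ I v (deg≤ v)) T∪Z⊆T N (V⊆Y I 1≤I ≤-refl v∈V)
      where
      V⊆Y : ∀ i → 1 ≤ i → i ≤ I → V ⊆ Y ℓ i
      V⊆Y (suc i) _ i<I = D-empty⇒V⊆Y D-empty ℓ i<I

      deg≤ : ∀ v → Outdeg v ≤ 2 ^ I
      deg≤ v = ≤-trans (p⊆q⇒∣p∣≤∣q∣ (proj₂ ∘ E⊆V×V)) V≤

      T∪Z⊆T : T ℓ ∪ Z I ⊆ T ℓ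
      T∪Z⊆T v∈ with x∈p∪q⁻ (T ℓ) (Z I) v∈
      ... | inj₁ v∈T = v∈T
      ... | inj₂ v∈Z with x∈p∪q⁻ (V[ player₂ ] ∩ _) _ v∈Z
      -- Level `I` keeps an edge of each live vertex; deleting its end from an out-set of size 0
      -- would give a size below 0.
      ...   | inj₁ deadEnd =
        let v∈V₂ , deg0 = x∈p∩q⁻ V[ player₂ ] _ deadEnd
            w , w∈      = live (proj₁ (∈V[]⁻ G v∈V₂))
        in contradiction (subst (∣ Arena.Out (Gᵢ I) _ - w ∣ <_) (∈⟦⟧⁻ (λ v → Arena.Outdeg (Gᵢ I) v ≟ 0) deg0)
                                (x∈p⇒∣p-x∣<∣p∣ (decompose-Out⊇ I _ (deg≤ _) w∈)))
                         n≮0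
      ...   | inj₂ large =
        contradiction (deg≤ _)
          (<⇒≱ (∈⟦⟧⁻ (λ v → 2 ^ I <? Outdeg v) (proj₂ (x∈p∩q⁻ V[ player₁ ] _ large))))

-- Invariants of the iterations, and correctness of the result.

module _ (𝒢 : GameGraph N) (T : Fin k → Subset N) (order : (G : Arena N) → InOrder G) (I : ℕ) where
  open GenBuchiGame order I (GameGraph.arena 𝒢) T

  -- Each graph is compared with `𝒢` rather than with its predecessor, so the strategy built on the
  -- last one is a strategy in `𝒢`.
  graph-Trap : ∀ j → Player₂Trap (GameGraph.arena 𝒢) (graph j)
  graph-Trap zero    = Player₂Trap-refl 𝒢
  graph-Trap (suc j) = Player₂Trap-∖Attr (graph-Trap j)
    (Iteration.S (graph j) (order (graph j)) I (target j))

  target⊆T : ∀ j ℓ → target j ℓ ⊆ T ℓ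
  target⊆T zero    ℓ v∈ = v∈
  target⊆T (suc j) ℓ v∈ = target⊆T j ℓ (p─q⊆p (target j ℓ) (D j) v∈)

proposition3p6 : ∀ {N k : ℕ} (𝒢 : GameGraph N) (T : Fin k → Subset N) →
    (∀ ℓ → T ℓ ⊆ GameGraph.V 𝒢) →
    (order : (G : Arena N) → InOrder G) →
    (I : ℕ) → IsLeastExponent ∣ GameGraph.V 𝒢 ∣ I →
    ∀ v → v ∈ GenBuchiGame.result order I (GameGraph.arena 𝒢) T →
    Winning 𝒢 player₁ (GenBüchi T) v
proposition3p6 𝒢 T _ order I ((1≤I , V≤) , _) =
  Player₂Trap-Winning T (target j*) (target⊆T 𝒢 T order I j*) trap
    (D-empty⇒V⊆Attr (graph j*) (order (graph j*)) I (target j*)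
      -- The bound by `2 ^ I` for `𝒢` passes to the smaller vertex set of the last graph.
      (Player₂Trap.live trap) 1≤I (≤-trans (p⊆q⇒∣p∣≤∣q∣ (Player₂Trap.V⊆ trap)) V≤)
      (proj₁ (proj₂ terminates)))
  where
  open GenBuchiGame order I (GameGraph.arena 𝒢) T

  trap : Player₂Trap (GameGraph.arena 𝒢) (graph j*)
  trap = graph-Trap 𝒢 T order I j*
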